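{- If $\mathfrak{g}$ is either atom or loose guards, there is a natural isomorphism \[ \theta : H^{\mathfrak{g}}_k \circ \mathbb{G}_{k}^{\mathfrak{g}} \; \cong \; \mathbb{H}_{k} \circ H^{\mathfrak{g}}_k \] which commutes with the counits and comultiplications of $\mathbb{G}_{k}$ and $\mathbb{H}_{k}$ (i.e. $\varepsilon_{H\mathcal{A}}\circ\theta_{\mathcal{A}}=H\varepsilon_{\mathcal{A}}$ and $\delta_{H\mathcal{A}}\circ\theta_{\mathcal{A}}=\mathbb{H}_k\theta_{\mathcal{A}}\circ\theta_{\mathbb{G}_k\mathcal{A}}\circ H\delta_{\mathcal{A}}$). Thus $\theta$ forms an Eilenberg-Moore law.
   Context: $H^{\mathfrak{g}}_k$ sends a $\sigma$-structure $\mathcal{A}$ to the hypergraph $(A,E)$ with $E$ the $k$-guarded $\mathfrak{g}$-guarded subsets of $\mathcal{A}$. $\mathbb{G}_k^{\mathfrak{g}}$ (on $\sigma$-structures) and $\mathbb{H}_k$ (on hypergraphs) are built from equivalence classes $[p,a]$ of focussed plays $\langle p,a\rangle$, $p$ a non-empty list of $k$-guarded sets (resp. hyperedges of size $\le k$) and $a$ in the last element, where $\langle p,a\rangle\sim\langle q,a'\rangle$ iff $a=a'$, $p\sqcap q$ non-empty, and $a$ lies in the last element of every play on the prefix-order paths from $p\sqcap q$ to $p$ and $q$. In $\mathbb{G}_k\mathcal{A}$, $R^{\mathbb{G}_k\mathcal{A}}=\{([p,a_1],\ldots,[p,a_r])\mid R^{\mathcal{A}}(a_1,\ldots,a_r)\}$;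 in $\mathbb{H}_k(V,E)$ the hyperedges are $\{[p,a]\mid a\in U\}$ with $U$ the last element of $p$. In both, $\varepsilon([p,a])=a$ and $\delta([[U_1,\ldots,U_n],a])=[[T_1,\ldots,T_n],[[U_1,\ldots,U_n],a]]$ with $T_j=\{[[U_1,\ldots,U_j],b]\mid b\in U_j\}$. -}

module Defs where

open import Level using (Level; _⊔_) renaming (suc to lsuc)
open import Data.Nat.Base using (ℕ; zero; suc; _≤_; z≤n; s≤s)
open import Data.Nat.Properties using (≤-refl; ≤-trans; ≤-reflexive; m≤n⇒m≤1+n; <-irrefl)
open import Data.Fin.Base using (Fin)
open import Data.Vec.Functional using (Vector)
open import Data.List.Base as List using (List; []; _∷_; length)
open import Data.List.Properties using (length-map)
import Data.List.Membership.Setoid as Membership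
import Data.List.Membership.Setoid.Properties as Membershipₚ
open import Data.List.Relation.Unary.Any using (here; there)
open import Data.Product.Base using (Σ; Σ-syntax; ∃; ∃-syntax; _×_; _,_; proj₁; proj₂)
open import Data.Sum.Base using (_⊎_; inj₁; inj₂)
open import Data.Empty using (⊥-elim)
open import Function.Base using (_∘′_)
open import Function.Bundles using (Func)
import Function.Construct.Identity as Identity
import Function.Construct.Composition as Composition
open import Relation.Nullary.Negation.Core using (¬_)
open import Relation.Unary using (Pred; _≐_)
open import Relation.Unary.Properties using (≐-refl; ≐-sym; ≐-trans)
open import Relation.Binary.Core using (Rel; _⇒_)
open import Relation.Binary.Bundles using (Setoid)
open import Relation.Binary.Structures using (IsEquivalence)
open import Relation.Binary.Definitions using (_Respects_)
open import Relation.Binary.PropositionalEquality using (_≡_; refl)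
open import Relation.Binary.Construct.Closure.Equivalence as EqC using (EqClosure)

open Setoid using (Carrier)
open Func using (to; cong)

record Category (o m e : Level) : Set (lsuc (o ⊔ m ⊔ e)) where
  infix  4 _≈_ _⟶_
  infixr 9 _∘_
  field
    Obj       : Set o
    _⟶_       : Obj → Obj → Set m
    _≈_       : ∀ {A B} → Rel (A ⟶ B) e
    id        : ∀ {A} → A ⟶ A
    _∘_       : ∀ {A B C} → B ⟶ C → A ⟶ B → A ⟶ C
    equiv     : ∀ {A B} → IsEquivalence (_≈_ {A} {B})
    assoc     : ∀ {A B C D} {f : A ⟶ B} {g : B ⟶ C} {h : C ⟶ D} →
                (h ∘ g) ∘ f ≈ h ∘ (g ∘ f)
    identityˡ : ∀ {A B} {f : A ⟶ B} → id ∘ f ≈ f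
    identityʳ : ∀ {A B} {f : A ⟶ B} → f ∘ id ≈ f
    ∘-resp-≈  : ∀ {A B C} {f f′ : B ⟶ C} {g g′ : A ⟶ B} →
                f ≈ f′ → g ≈ g′ → f ∘ g ≈ f′ ∘ g′

private
  variable
    o m e o′ m′ e′ o″ m″ e″ : Level

record Functor (C : Category o m e) (D : Category o′ m′ e′)
       : Set (o ⊔ m ⊔ e ⊔ o′ ⊔ m′ ⊔ e′) where
  private
    module C = Category C
    module D = Category D
  field
    F₀           : C.Obj → D.Obj
    F₁           : ∀ {A B} → A C.⟶ B → F₀ A D.⟶ F₀ B
    F-resp-≈     : ∀ {A B} {f g : A C.⟶ B} → f C.≈ g → F₁ f D.≈ F₁ g
    identity     : ∀ {A} → F₁ (C.id {A}) D.≈ D.id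
    homomorphism : ∀ {X Y Z} {f : X C.⟶ Y} {g : Y C.⟶ Z} →
                   F₁ (g C.∘ f) D.≈ F₁ g D.∘ F₁ f

idF : {C : Category o m e} → Functor C C
idF {C = C} = record
  { F₀ = λ A → A ; F₁ = λ f → f ; F-resp-≈ = λ eq → eq
  ; identity = IsEquivalence.refl equiv ; homomorphism = IsEquivalence.refl equiv }
  where open Category C

infixr 9 _∘F_
_∘F_ : {C : Category o m e} {D : Category o′ m′ e′} {E : Category o″ m″ e″} →
       Functor D E → Functor C D → Functor C E
_∘F_ {E = E} G F = record
  { F₀ = λ A → G.F₀ (F.F₀ A)
  ; F₁ = λ f → G.F₁ (F.F₁ f)
  ; F-resp-≈ = λ eq → G.F-resp-≈ (F.F-resp-≈ eq)
  ; identity = IsEquivalence.trans equiv (G.F-resp-≈ F.identity) G.identity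
  ; homomorphism = IsEquivalence.trans equiv (G.F-resp-≈ F.homomorphism) G.homomorphism
  }
  where
  open Category E
  module G = Functor G
  module F = Functor F

module _ {C : Category o m e} {D : Category o′ m′ e′} where
  private
    module C = Category C
    module D = Category D

  record NaturalTransformation (F G : Functor C D) : Set (o ⊔ m ⊔ m′ ⊔ e′) where
    private
      module F = Functor F
      module G = Functor G
    field
      η       : ∀ A → F.F₀ A D.⟶ G.F₀ A
      natural : ∀ {A B} (f : A C.⟶ B) → η B D.∘ F.F₁ f D.≈ G.F₁ f D.∘ η A

  record NaturalIsomorphism (F G : Functor C D) : Set (o ⊔ m ⊔ m′ ⊔ e′) where
    private
      module F = Functor F
      module G = Functor G
    field
      forward : NaturalTransformation F G
    open NaturalTransformation forward public
    field
      η⁻¹  : ∀ A → G.F₀ A D.⟶ F.F₀ A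
      isoˡ : ∀ A → η⁻¹ A D.∘ η A D.≈ D.id
      isoʳ : ∀ A → η A D.∘ η⁻¹ A D.≈ D.id

record Comonad (C : Category o m e) : Set (o ⊔ m ⊔ e) where
  open Category C
  field
    functor : Functor C C
  open Functor functor public
  field
    counit : NaturalTransformation functor idF
    comult : NaturalTransformation functor (functor ∘F functor)
  module ε = NaturalTransformation counit
  module δ = NaturalTransformation comult
  field
    counitˡ : ∀ A → ε.η (F₀ A) ∘ δ.η A ≈ id
    counitʳ : ∀ A → F₁ (ε.η A) ∘ δ.η A ≈ id
    coassoc : ∀ A → δ.η (F₀ A) ∘ δ.η A ≈ F₁ (δ.η A) ∘ δ.η A

record IsEilenbergMooreLaw {C : Category o m e} {D : Category o′ m′ e′}
       (G : Comonad C) (H : Comonad D) (K : Functor C D)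
       (θ : NaturalTransformation (K ∘F Comonad.functor G) (Comonad.functor H ∘F K))
       : Set (o ⊔ e′) where
  private
    module C = Category C
    module G = Comonad G
    module H = Comonad H
    module K = Functor K
    module θ = NaturalTransformation θ
  open Category D
  field
    counit-law : ∀ A → H.ε.η (K.F₀ A) ∘ θ.η A ≈ K.F₁ (G.ε.η A)
    comult-law : ∀ A → H.δ.η (K.F₀ A) ∘ θ.η A
                       ≈ H.F₁ (θ.η A) ∘ (θ.η (G.F₀ A) ∘ K.F₁ (G.δ.η A))

-- The power set of a small type is not small, so a set of subsets is
-- presented as a small family; two indices with the same extent stand for
-- the same subset.

module _ {ℓ : Level} where

  private
    variable
      X Y Z : Setoid ℓ ℓ

  record Subsets (X : Setoid ℓ ℓ) : Set (lsuc ℓ) where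
    open Setoid X using (_≈_)
    field
      Index  : Set ℓ
      extent : Index → Pred (Carrier X) ℓ
      resp   : ∀ i → extent i Respects _≈_

  open Subsets using (Index; extent; resp)

  image : Func X Y → Pred (Carrier X) ℓ → Pred (Carrier Y) ℓ
  image {Y = Y} f P y = ∃[ x ] P x × Setoid._≈_ Y y (to f x)

  record MapsTo {X Y : Setoid ℓ ℓ} (f : Func X Y) (F : Subsets X) (G : Subsets Y) : Set ℓ where
    field
      img   : Index F → Index G
      img-≐ : ∀ U → extent G (img U) ≐ image f (extent F U)

  open MapsTo

  Size≤ : (X : Setoid ℓ ℓ) → ℕ → Pred (Carrier X) ℓ → Set ℓ
  Size≤ X k P = Σ[ xs ∈ List (Carrier X) ] length xs ≤ k × P ≐ (_∈ xs)
    where open Membership X using (_∈_)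

  infixr 9 _∘→_
  _∘→_ : Func Y Z → Func X Y → Func X Z
  g ∘→ f = Composition.function f g

  image-≐ : (f : Func X Y) {P Q : Pred (Carrier X) ℓ} → P ≐ Q → image f P ≐ image f Q
  image-≐ f (P⊆Q , Q⊆P) = (λ (x , px , eq) → x , P⊆Q px , eq)
                        , (λ (x , qx , eq) → x , Q⊆P qx , eq)

  image-∘ : (f : Func X Y) (g : Func Y Z) {P : Pred (Carrier X) ℓ} →
            image (g ∘→ f) P ≐ image g (image f P)
  image-∘ {Y = Y} {Z = Z} f g =
      (λ (x , px , eq) → to f x , (x , px , Setoid.refl Y) , eq)
    , (λ (y , (x , px , eq′) , eq) → x , px , Setoid.trans Z eq (cong g eq′))

  image-ext : (f g : Func X Y) → (∀ x → Setoid._≈_ Y (to f x) (to g x)) →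
              {P : Pred (Carrier X) ℓ} → image f P ≐ image g P
  image-ext {Y = Y} f g f≈g =
      (λ (x , px , eq) → x , px , Setoid.trans Y eq (f≈g x))
    , (λ (x , px , eq) → x , px , Setoid.trans Y eq (Setoid.sym Y (f≈g x)))

  image-id : {P : Pred (Carrier X) ℓ} → P Respects Setoid._≈_ X →
             image (Identity.function X) P ≐ P
  image-id {X = X} r = (λ (x , px , eq) → r (Setoid.sym X eq) px)
                     , (λ {x} px → x , px , Setoid.refl X)

  MapsTo-id : (F : Subsets X) → MapsTo (Identity.function X) F F
  MapsTo-id {X = X} F = record { img = λ U → U ; img-≐ = λ U → ≐-sym (image-id {X = X} {P = extent F U} (resp F U)) }

  MapsTo-∘ : {F : Subsets X} {G : Subsets Y} {H : Subsets Z} {f : Func X Y} {g : Func Y Z} →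
             MapsTo g G H → MapsTo f F G → MapsTo (g ∘→ f) F H
  MapsTo-∘ {f = f} {g} mg mf = record
    { img   = λ U → img mg (img mf U)
    ; img-≐ = λ U → ≐-trans (img-≐ mg (img mf U))
                      (≐-trans (image-≐ g (img-≐ mf U)) (≐-sym (image-∘ f g))) }

  Size≤-image : (f : Func X Y) {k : ℕ} {P : Pred (Carrier X) ℓ} →
                Size≤ X k P → Size≤ Y k (image f P)
  Size≤-image {X = X} {Y = Y} f (xs , len , P⊆ , ⊆P) =
    List.map (to f) xs , ≤-trans (≤-reflexive (length-map (to f) xs)) len ,
    (λ (x , px , eq) →
       Membershipₚ.∈-resp-≈ Y (Setoid.sym Y eq) (Membershipₚ.∈-map⁺ X Y (cong f) (P⊆ px))) ,
    (λ y∈ → let x , x∈ , eq = Membershipₚ.∈-map⁻ X Y y∈ in x , ⊆P x∈ , eq)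

  Size≤-≐ : {k : ℕ} {P Q : Pred (Carrier X) ℓ} → P ≐ Q → Size≤ X k P → Size≤ X k Q
  Size≤-≐ P≐Q (xs , len , P≐) = xs , len , ≐-trans (≐-sym P≐Q) P≐

  -- Non-empty lists of members of F, with the last element outermost.
  infixl 5 _▷_
  data Play {X : Setoid ℓ ℓ} (F : Subsets X) : Set ℓ where
    [_] : Index F → Play F
    _▷_ : Play F → Index F → Play F

  module _ {X : Setoid ℓ ℓ} {F : Subsets X} where

    last : Play F → Index F
    last [ U ]   = U
    last (p ▷ U) = U

    lastSet : Play F → Pred (Carrier X) ℓ
    lastSet p = extent F (last p)

    infix 4 _≋_ _⊑_

    data _≋_ : Rel (Play F) ℓ where
      [_] : ∀ {U V} → extent F U ≐ extent F V → [ U ] ≋ [ V ]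
      _▷_ : ∀ {p q U V} → p ≋ q → extent F U ≐ extent F V → p ▷ U ≋ q ▷ V

    data _⊑_ : Rel (Play F) ℓ where
      equal  : ∀ {p q} → p ≋ q → p ⊑ q
      extend : ∀ {p q U} → p ⊑ q → p ⊑ q ▷ U

    record IsMeet (r p q : Play F) : Set ℓ where
      field
        below₁   : r ⊑ p
        below₂   : r ⊑ q
        greatest : ∀ s → s ⊑ p → s ⊑ q → s ⊑ r

    LiesAlong : Carrier X → Play F → Play F → Set ℓ
    LiesAlong a r p = ∀ s → r ⊑ s → s ⊑ p → lastSet s a

  record FocussedPlay {X : Setoid ℓ ℓ} (F : Subsets X) : Set ℓ where
    constructor ⟨_,_,_⟩
    field
      play   : Play F
      focus  : Carrier X
      focus∈ : lastSet play focus

  open FocussedPlay using (play; focus; focus∈)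

  -- Plays are non-empty, so the existence of a meet here says that the longest
  -- common prefix in the sense of possibly empty lists is non-empty.
  infix 4 _∼_
  record _∼_ {X : Setoid ℓ ℓ} {F : Subsets X} (x y : FocussedPlay F) : Set ℓ where
    field
      sameFocus : Setoid._≈_ X (focus x) (focus y)
      meet      : Play F
      isMeet    : IsMeet meet (play x) (play y)
      along₁    : LiesAlong (focus x) meet (play x)
      along₂    : LiesAlong (focus y) meet (play y)

  -- Equivalence classes [p, a].  Constructively meets of plays need not exist, so
  -- transitivity of _∼_ is not available and the quotient is by the generated
  -- equivalence.  When meets exist (as they do classically) the closure adds
  -- nothing: see closure-redundant.
  FocussedPlays : {X : Setoid ℓ ℓ} → Subsets X → Setoid ℓ ℓ
  FocussedPlays F = EqC.setoid (_∼_ {F = F})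

  -- The set {[p, a] ∣ a ∈ U}, for U the last element of p.
  fibre : {X : Setoid ℓ ℓ} {F : Subsets X} → Play F → Pred (FocussedPlay F) ℓ
  fibre {F = F} p x = ∃[ a ] Σ[ a∈ ∈ lastSet p a ] Setoid._≈_ (FocussedPlays F) x ⟨ p , a , a∈ ⟩

  module _ {X : Setoid ℓ ℓ} {F : Subsets X} where
    private
      module X = Setoid X
      module P = Setoid (FocussedPlays F)

    ≋-refl : ∀ {p : Play F} → p ≋ p
    ≋-refl {[ U ]}   = [ ≐-refl ]
    ≋-refl {p ▷ U} = ≋-refl ▷ ≐-refl

    ≋-sym : ∀ {p q : Play F} → p ≋ q → q ≋ p
    ≋-sym [ e ]   = [ ≐-sym e ]
    ≋-sym (d ▷ e) = ≋-sym d ▷ ≐-sym e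

    ≋-trans : ∀ {p q r : Play F} → p ≋ q → q ≋ r → p ≋ r
    ≋-trans [ e ]   [ e′ ]    = [ ≐-trans e e′ ]
    ≋-trans (d ▷ e) (d′ ▷ e′) = ≋-trans d d′ ▷ ≐-trans e e′

    last-≋ : ∀ {p q : Play F} → p ≋ q → lastSet p ≐ lastSet q
    last-≋ [ e ]   = e
    last-≋ (d ▷ e) = e

    ⊑-respʳ : ∀ {p q r : Play F} → p ⊑ q → q ≋ r → p ⊑ r
    ⊑-respʳ (equal e)  e′       = equal (≋-trans e e′)
    ⊑-respʳ (extend l) (d ▷ _) = extend (⊑-respʳ l d)

    ⊑-trans : ∀ {p q r : Play F} → p ⊑ q → q ⊑ r → p ⊑ r
    ⊑-trans l (equal e)   = ⊑-respʳ l e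
    ⊑-trans l (extend l′) = extend (⊑-trans l l′)

    private
      len : Play F → ℕ
      len [ _ ]   = zero
      len (p ▷ _) = suc (len p)

      len-≋ : ∀ {p q} → p ≋ q → len p ≤ len q
      len-≋ [ _ ]   = z≤n
      len-≋ (d ▷ _) = s≤s (len-≋ d)

      len-⊑ : ∀ {p q} → p ⊑ q → len p ≤ len q
      len-⊑ (equal e)  = len-≋ e
      len-⊑ (extend l) = m≤n⇒m≤1+n (len-⊑ l)

    ⊑-irrefl : ∀ {p : Play F} {U} → ¬ (p ▷ U ⊑ p)
    ⊑-irrefl l = <-irrefl refl (len-⊑ l)

    -- Inductive form of r ⊑ p together with LiesAlong a r p.
    data Path (a : Carrier X) (r : Play F) : Play F → Set ℓ where
      stop : ∀ {p} → r ≋ p → lastSet p a → Path a r p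
      step : ∀ {p U} → Path a r p → extent F U a → Path a r (p ▷ U)

    Path⇒⊑ : ∀ {a r p} → Path a r p → r ⊑ p
    Path⇒⊑ (stop e _)  = equal e
    Path⇒⊑ (step π _) = extend (Path⇒⊑ π)

    Path⇒LiesAlong : ∀ {a r p} → Path a r p → LiesAlong a r p
    Path⇒LiesAlong (stop e a∈) s r⊑s (equal e′)   = proj₂ (last-≋ e′) a∈
    Path⇒LiesAlong (stop e a∈) s r⊑s (extend l)   =
      ⊥-elim (⊑-irrefl (⊑-trans (⊑-trans (equal (≋-sym e)) r⊑s) l))
    Path⇒LiesAlong (step π a∈) s r⊑s (equal e′)   = proj₂ (last-≋ e′) a∈
    Path⇒LiesAlong (step π a∈) s r⊑s (extend l)   = Path⇒LiesAlong π s r⊑s l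

    LiesAlong⇒Path : ∀ {a r p} → r ⊑ p → LiesAlong a r p → Path a r p
    LiesAlong⇒Path (equal e)  h = stop e (h _ (equal e) (equal ≋-refl))
    LiesAlong⇒Path (extend l) h =
      step (LiesAlong⇒Path l (λ s r⊑s s⊑p → h s r⊑s (extend s⊑p)))
           (h _ (extend l) (equal ≋-refl))

    Path-end : ∀ {a r p} → Path a r p → lastSet p a
    Path-end (stop _ a∈) = a∈
    Path-end (step _ a∈) = a∈

    Path-start : ∀ {a r p} → Path a r p → lastSet r a
    Path-start (stop e a∈) = proj₂ (last-≋ e) a∈
    Path-start (step π _) = Path-start π

    Path-respʳ : ∀ {a r p q} → Path a r p → p ≋ q → Path a r q
    Path-respʳ (stop e a∈) e′       = stop (≋-trans e e′) (proj₁ (last-≋ e′) a∈)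
    Path-respʳ (step π a∈) (d ▷ e) = step (Path-respʳ π d) (proj₁ e a∈)

    Path-respˡ : ∀ {a r s p} → r ≋ s → Path a r p → Path a s p
    Path-respˡ e (stop e′ a∈) = stop (≋-trans (≋-sym e) e′) a∈
    Path-respˡ e (step π a∈) = step (Path-respˡ e π) a∈

    Path-resp-≈ : ∀ {a b r p} → a X.≈ b → Path a r p → Path b r p
    Path-resp-≈ eq (stop {p} e a∈)      = stop e (resp F (last p) eq a∈)
    Path-resp-≈ eq (step {U = U} π a∈) = step (Path-resp-≈ eq π) (resp F U eq a∈)

    Path-trans : ∀ {a r s p} → Path a r s → Path a s p → Path a r p
    Path-trans π (stop e _)   = Path-respʳ π e
    Path-trans π (step ρ a∈) = step (Path-trans π ρ) a∈

    Path-compare : ∀ {a r s p} → Path a r p → Path a s p → Path a r s ⊎ Path a s r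
    Path-compare π            (stop e _)   = inj₁ (Path-respʳ π (≋-sym e))
    Path-compare (stop e a∈) ρ@(step _ _) = inj₂ (Path-respʳ ρ (≋-sym e))
    Path-compare (step π _)  (step ρ _)  = Path-compare π ρ

    infix 4 _≃_
    record _≃_ (x y : FocussedPlay F) : Set ℓ where
      constructor ≃[_,_,_,_]
      field
        eqFocus : focus x X.≈ focus y
        root    : Play F
        path₁   : Path (focus x) root (play x)
        path₂   : Path (focus y) root (play y)

    ≃-isEquivalence : IsEquivalence _≃_
    ≃-isEquivalence = record
      { refl  = λ {x} → ≃[ X.refl , play x , stop ≋-refl (focus∈ x) , stop ≋-refl (focus∈ x) ]
      ; sym   = λ (≃[ eq , r , π , ρ ]) → ≃[ X.sym eq , r , ρ , π ]
      ; trans = ≃-trans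
      }
      where
      ≃-trans : ∀ {x y z} → x ≃ y → y ≃ z → x ≃ z
      ≃-trans ≃[ xy , r , π , ρ ] ≃[ yz , s , σ , τ ] with Path-compare ρ σ
      ... | inj₁ υ = ≃[ X.trans xy yz , r , π , Path-trans (Path-resp-≈ yz υ) τ ]
      ... | inj₂ υ = ≃[ X.trans xy yz , s , Path-trans (Path-resp-≈ (X.sym xy) υ) π , τ ]

    ∼⇒≃ : _∼_ ⇒ _≃_
    ∼⇒≃ x∼y = ≃[ sameFocus , meet , LiesAlong⇒Path (IsMeet.below₁ isMeet) along₁
                                   , LiesAlong⇒Path (IsMeet.below₂ isMeet) along₂ ]
      where open _∼_ x∼y

    ≈⇒≃ : ∀ {x y} → x P.≈ y → x ≃ y
    ≈⇒≃ = EqC.fold ≃-isEquivalence ∼⇒≃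

    ≃⇒≈ : ∀ {x y} → x ≃ y → x P.≈ y
    ≃⇒≈ {x} {y} ≃[ eq , r , π , ρ ] =
      P.trans (EqC.return {_} (toRoot x X.refl π))
              (P.sym (EqC.return {_} (toRoot y (X.sym eq) ρ)))
      where
      toRoot : ∀ z (eq : focus z X.≈ focus x) (τ : Path (focus z) r (play z)) →
               z ∼ ⟨ r , focus x , Path-start π ⟩
      toRoot z eq τ = record
        { sameFocus = eq
        ; meet      = r
        ; isMeet    = record { below₁ = Path⇒⊑ τ ; below₂ = equal ≋-refl
                             ; greatest = λ _ _ l → l }
        ; along₁    = Path⇒LiesAlong τ
        ; along₂    = Path⇒LiesAlong (stop ≋-refl (Path-start π))
        }

    closure-redundant :
      (∀ (p q r : Play F) → r ⊑ p → r ⊑ q → ∃[ m ] IsMeet m p q) →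
      EqClosure (_∼_ {F = F}) ⇒ _∼_
    closure-redundant meets {x} {y} x≈y with ≈⇒≃ x≈y
    ... | ≃[ eq , r , π , ρ ] with meets (play x) (play y) r (Path⇒⊑ π) (Path⇒⊑ ρ)
    ...   | m , isMeet = record
      { sameFocus = eq ; meet = m ; isMeet = isMeet
      ; along₁ = λ s m⊑s → Path⇒LiesAlong π s (⊑-trans r⊑m m⊑s)
      ; along₂ = λ s m⊑s → Path⇒LiesAlong ρ s (⊑-trans r⊑m m⊑s) }
      where r⊑m = IsMeet.greatest isMeet r (Path⇒⊑ π) (Path⇒⊑ ρ)

    ≋⇒≈ : ∀ {x y : FocussedPlay F} → play x ≋ play y → focus x X.≈ focus y → x P.≈ y
    ≋⇒≈ {x} {y} e eq =
      ≃⇒≈ ≃[ eq , play x , stop ≋-refl (focus∈ x) , stop e (focus∈ y) ]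

    Path⇒≈ : ∀ {a r p} (π : Path a r p) (a∈r : lastSet r a) (a∈p : lastSet p a) →
             ⟨ r , a , a∈r ⟩ P.≈ ⟨ p , a , a∈p ⟩
    Path⇒≈ {r = r} π a∈r a∈p = ≃⇒≈ ≃[ X.refl , r , stop ≋-refl a∈r , π ]

    fibre-resp : ∀ p → fibre p Respects P._≈_
    fibre-resp p x≈y (a , a∈ , eq) = a , a∈ , P.trans (P.sym x≈y) eq

    fibre-≋ : ∀ {p q : Play F} → p ≋ q → fibre p ≐ fibre q
    fibre-≋ p≋q = half p≋q , half (≋-sym p≋q)
      where
      half : ∀ {p q : Play F} → p ≋ q → ∀ {x} → fibre p x → fibre q x
      half e (a , a∈ , eq) = a , proj₁ (last-≋ e) a∈ , P.trans eq (≋⇒≈ e X.refl)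

    Size≤-fibre : ∀ {k} (p : Play F) → Size≤ X k (lastSet p) →
                  Size≤ (FocussedPlays F) k (fibre p)
    Size≤-fibre {k} p (xs , size , P⊆ , ⊆P) =
      mapWith∈ xs f , ≤-trans (≤-reflexive (Membershipₚ.length-mapWith∈ X xs)) size , fwd , bwd xs ⊆P
      where
      open Membership X using (_∈_; mapWith∈)
      open Membership (FocussedPlays F) using () renaming (_∈_ to _∈ᴾ_)
      f : ∀ {x} → x ∈ xs → FocussedPlay F
      f {x} x∈ = ⟨ p , x , ⊆P x∈ ⟩

      into : ∀ ys (g : ∀ {y} → y ∈ ys → lastSet p y) {a} (a∈ : lastSet p a) → a ∈ ys →
             ⟨ p , a , a∈ ⟩ ∈ᴾ mapWith∈ ys (λ {y} y∈ → ⟨ p , y , g y∈ ⟩)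
      into (y ∷ ys) g a∈ (here a≈y) = here (≋⇒≈ ≋-refl a≈y)
      into (y ∷ ys) g a∈ (there a∈ys) = there (into ys (g ∘′ there) a∈ a∈ys)

      fwd : ∀ {x} → fibre p x → x ∈ᴾ mapWith∈ xs f
      fwd (a , a∈ , eq) =
        Membershipₚ.∈-resp-≈ (FocussedPlays F) (P.sym eq) (into xs ⊆P a∈ (P⊆ a∈))

      bwd : ∀ ys (g : ∀ {y} → y ∈ ys → lastSet p y) {x} →
            x ∈ᴾ mapWith∈ ys (λ {y} y∈ → ⟨ p , y , g y∈ ⟩) → fibre p x
      bwd (y ∷ ys) g (here eq) = y , g (here X.refl) , eq
      bwd (y ∷ ys) g (there x∈) = bwd ys (g ∘′ there) x∈

    ε-focus : Func (FocussedPlays F) X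
    ε-focus = record { to = focus ; cong = λ x≈y → _≃_.eqFocus (≈⇒≃ x≈y) }

    image-ε-fibre : ∀ p → image ε-focus (fibre p) ≐ lastSet p
    image-ε-fibre p =
        (λ (x , (b , b∈ , eq) , a≈) →
           resp F (last p) (X.sym (X.trans a≈ (cong ε-focus eq))) b∈)
      , (λ {a} a∈ → ⟨ p , a , a∈ ⟩ , (a , a∈ , P.refl) , X.refl)

  -- [U₁, …, Uₙ] ↦ [f U₁, …, f Uₙ]
  mapPlay : {F : Subsets X} {G : Subsets Y} {f : Func X Y} → MapsTo f F G → Play F → Play G
  mapPlay mf [ U ]   = [ img mf U ]
  mapPlay mf (p ▷ U) = mapPlay mf p ▷ img mf U

  mapPlay-last : {F : Subsets X} {G : Subsets Y} {f : Func X Y} (mf : MapsTo f F G) (p : Play F) →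
                 lastSet (mapPlay {f = f} mf p) ≐ image f (lastSet p)
  mapPlay-last mf [ U ]   = img-≐ mf U
  mapPlay-last mf (p ▷ U) = img-≐ mf U

  module _ {X Y : Setoid ℓ ℓ} {F : Subsets X} {G : Subsets Y}
           {f : Func X Y} (mf : MapsTo f F G) where
    private
      module Y = Setoid Y

      mapPlay-≋ : ∀ {p q} → p ≋ q → mapPlay mf p ≋ mapPlay mf q
      mapPlay-≋ ([_] {U} {V} e) =
        [ ≐-trans (img-≐ mf U) (≐-trans (image-≐ f e) (≐-sym (img-≐ mf V))) ]
      mapPlay-≋ (_▷_ {U = U} {V} d e) =
        mapPlay-≋ d ▷ ≐-trans (img-≐ mf U) (≐-trans (image-≐ f e) (≐-sym (img-≐ mf V)))

      mapPlay-Path : ∀ {a r p} → Path a r p → Path (to f a) (mapPlay mf r) (mapPlay mf p)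
      mapPlay-Path (stop {p} e a∈) =
        stop (mapPlay-≋ e) (proj₂ (mapPlay-last mf p) (_ , a∈ , Y.refl))
      mapPlay-Path (step {U = U} π a∈) =
        step (mapPlay-Path π) (proj₂ (img-≐ mf U) (_ , a∈ , Y.refl))

    mapFocussed : Func (FocussedPlays F) (FocussedPlays G)
    mapFocussed = record
      { to   = λ x → ⟨ mapPlay mf (play x) , to f (focus x)
                     , proj₂ (mapPlay-last mf (play x)) (focus x , focus∈ x , Y.refl) ⟩
      ; cong = λ x≈y → let ≃[ eq , r , π , ρ ] = ≈⇒≃ x≈y in
               ≃⇒≈ ≃[ cong f eq , mapPlay mf r , mapPlay-Path π , mapPlay-Path ρ ]
      }

    image-map-fibre : ∀ p → image mapFocussed (fibre p) ≐ fibre (mapPlay mf p)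
    image-map-fibre p =
        (λ (x , (a , a∈ , eq) , y≈) →
           to f a , proj₂ (mapPlay-last mf p) (a , a∈ , Y.refl) ,
           PG.trans y≈ (PG.trans (cong mapFocussed eq) (≋⇒≈ ≋-refl Y.refl)))
      , bwd
      where
      module PF = Setoid (FocussedPlays F)
      module PG = Setoid (FocussedPlays G)
      bwd : ∀ {y} → fibre (mapPlay mf p) y → image mapFocussed (fibre p) y
      bwd (b , b∈ , eq) with proj₁ (mapPlay-last mf p) b∈
      ... | a , a∈ , b≈ = ⟨ p , a , a∈ ⟩ , (a , a∈ , PF.refl) , PG.trans eq (≋⇒≈ ≋-refl b≈)

  mapPlay-ext : {F : Subsets X} {G : Subsets Y} {f g : Func X Y}
                (mf : MapsTo f F G) (mg : MapsTo g F G) →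
                (∀ x → Setoid._≈_ Y (to f x) (to g x)) → ∀ p → mapPlay mf p ≋ mapPlay mg p
  mapPlay-ext {f = f} {g} mf mg f≈g = go
    where
    same : ∀ U → _
    same U = ≐-trans (img-≐ mf U) (≐-trans (image-ext f g f≈g) (≐-sym (img-≐ mg U)))
    go : ∀ p → mapPlay mf p ≋ mapPlay mg p
    go [ U ]   = [ same U ]
    go (p ▷ U) = go p ▷ same U

  mapPlay-id : {F : Subsets X} (mf : MapsTo (Identity.function X) F F) → ∀ p → mapPlay mf p ≋ p
  mapPlay-id {X = X} {F = F} mf [ U ]   = [ ≐-trans (img-≐ mf U) (image-id {X = X} {P = extent F U} (resp F U)) ]
  mapPlay-id {X = X} {F = F} mf (p ▷ U) =
    mapPlay-id mf p ▷ ≐-trans (img-≐ mf U) (image-id {X = X} {P = extent F U} (resp F U))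

  mapPlay-∘ : {F : Subsets X} {G : Subsets Y} {H : Subsets Z} {f : Func X Y} {g : Func Y Z}
              (mf : MapsTo f F G) (mg : MapsTo g G H) (mgf : MapsTo (g ∘→ f) F H) →
              ∀ p → mapPlay mgf p ≋ mapPlay mg (mapPlay mf p)
  mapPlay-∘ {f = f} {g} mf mg mgf = go
    where
    same : ∀ U → _
    same U = ≐-trans (img-≐ mgf U) (≐-trans (image-∘ f g)
               (≐-sym (≐-trans (img-≐ mg (img mf U)) (image-≐ g (img-≐ mf U)))))
    go : ∀ p → mapPlay mgf p ≋ mapPlay mg (mapPlay mf p)
    go [ U ]   = [ same U ]
    go (p ▷ U) = go p ▷ same U

  -- A choice, for each play p, of a member of F̂ with extent {[p, b] ∣ b ∈ U}.
  record Fibres {X : Setoid ℓ ℓ} (F : Subsets X) (F̂ : Subsets (FocussedPlays F)) : Set ℓ where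
    field
      fib   : Play F → Index F̂
      fib-≐ : ∀ p → extent F̂ (fib p) ≐ fibre p

  open Fibres

  module _ {X : Setoid ℓ ℓ} {F : Subsets X} {F̂ : Subsets (FocussedPlays F)} where
    private
      module P = Setoid (FocussedPlays F)

    -- [U₁, …, Uₙ] ↦ [T₁, …, Tₙ] with Tⱼ = {[[U₁, …, Uⱼ], b] ∣ b ∈ Uⱼ}.
    fibres : Fibres F F̂ → Play F → Play F̂
    fibres T [ U ]   = [ fib T [ U ] ]
    fibres T (p ▷ U) = fibres T p ▷ fib T (p ▷ U)

    fibres-last : ∀ T p → lastSet (fibres T p) ≐ fibre p
    fibres-last T [ U ]   = fib-≐ T [ U ]
    fibres-last T (p ▷ U) = fib-≐ T (p ▷ U)

    module _ (T : Fibres F F̂) where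
      private
        same : ∀ {p q} → p ≋ q → extent F̂ (fib T p) ≐ extent F̂ (fib T q)
        same {p} {q} e = ≐-trans (fib-≐ T p) (≐-trans (fibre-≋ e) (≐-sym (fib-≐ T q)))

        fibres-≋ : ∀ {p q} → p ≋ q → fibres T p ≋ fibres T q
        fibres-≋ [ e ]   = [ same [ e ] ]
        fibres-≋ (d ▷ e) = fibres-≋ d ▷ same (d ▷ e)

        fibres-Path : ∀ {a r p} (π : Path a r p) {x} (a∈p : lastSet p a) →
                      x P.≈ ⟨ p , a , a∈p ⟩ → Path x (fibres T r) (fibres T p)
        fibres-Path (stop {p} e _) a∈p eq =
          stop (fibres-≋ e) (proj₂ (fibres-last T p) (_ , a∈p , eq))
        fibres-Path (step {p} {U} π a∈U) a∈p eq =
          step (fibres-Path π (Path-end π)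
                 (P.trans eq (P.sym (Path⇒≈ (step (stop ≋-refl (Path-end π)) a∈U) (Path-end π) a∈p))))
               (proj₂ (fib-≐ T (p ▷ U)) (_ , a∈p , eq))

      δ-fibres : Func (FocussedPlays F) (FocussedPlays F̂)
      δ-fibres = record
        { to   = λ x → ⟨ fibres T (play x) , x
                       , proj₂ (fibres-last T (play x)) (focus x , focus∈ x , P.refl) ⟩
        ; cong = λ {x} {y} x≈y → let ≃[ eq , r , π , ρ ] = ≈⇒≃ x≈y in
                 ≃⇒≈ ≃[ x≈y , fibres T r , fibres-Path π (focus∈ x) P.refl
                                         , fibres-Path ρ (focus∈ y) P.refl ]
        }

      image-δ-fibre : ∀ p → image δ-fibres (fibre p) ≐ fibre (fibres T p)
      image-δ-fibre p =
          (λ (x , (a , a∈ , eq) , y≈) →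
             ⟨ p , a , a∈ ⟩ , proj₂ (fibres-last T p) (a , a∈ , P.refl) ,
             PP.trans y≈ (PP.trans (cong δ-fibres eq) (≋⇒≈ ≋-refl P.refl)))
        , (λ (x , x∈ , eq) → let a , a∈ , x≈ = proj₁ (fibres-last T p) x∈ in
             ⟨ p , a , a∈ ⟩ , (a , a∈ , P.refl) ,
             PP.trans eq (≋⇒≈ ≋-refl x≈))
        where module PP = Setoid (FocussedPlays F̂)

      map-ε-fibres : (mε : MapsTo ε-focus F̂ F) → ∀ p → mapPlay mε (fibres T p) ≋ p
      map-ε-fibres mε = go
        where
        same′ : ∀ p → extent F (img mε (fib T p)) ≐ lastSet p
        same′ p = ≐-trans (img-≐ mε (fib T p))
                          (≐-trans (image-≐ ε-focus (fib-≐ T p)) (image-ε-fibre p))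
        go : ∀ p → mapPlay mε (fibres T p) ≋ p
        go [ U ]   = [ same′ [ U ] ]
        go (p ▷ U) = go p ▷ same′ (p ▷ U)

  map-δ-fibres : {F : Subsets X} {F̂ : Subsets (FocussedPlays F)}
                 {F̂̂ : Subsets (FocussedPlays F̂)}
                 (T : Fibres F F̂) (T̂ : Fibres F̂ F̂̂) (mδ : MapsTo (δ-fibres T) F̂ F̂̂) →
                 ∀ p → fibres T̂ (fibres T p) ≋ mapPlay mδ (fibres T p)
  map-δ-fibres T T̂ mδ = go
    where
    same : ∀ p → _
    same p = ≐-trans (fib-≐ T̂ (fibres T p)) (≐-sym
               (≐-trans (img-≐ mδ (fib T p))
                 (≐-trans (image-≐ (δ-fibres T) (fib-≐ T p)) (image-δ-fibre T p))))
    go : ∀ p → fibres T̂ (fibres T p) ≋ mapPlay mδ (fibres T p)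
    go [ U ]   = [ same [ U ] ]
    go (p ▷ U) = go p ▷ same (p ▷ U)

  fibres-natural : {F : Subsets X} {G : Subsets Y} {f : Func X Y} (mf : MapsTo f F G)
                   {F̂ : Subsets (FocussedPlays F)} {Ĝ : Subsets (FocussedPlays G)}
                   (S : Fibres F F̂) (T : Fibres G Ĝ) (mmf : MapsTo (mapFocussed mf) F̂ Ĝ) →
                   ∀ p → fibres T (mapPlay mf p) ≋ mapPlay mmf (fibres S p)
  fibres-natural mf S T mmf = go
    where
    same : ∀ p → _
    same p = ≐-trans (fib-≐ T (mapPlay mf p)) (≐-sym
               (≐-trans (img-≐ mmf (fib S p))
                 (≐-trans (image-≐ (mapFocussed mf) (fib-≐ S p)) (image-map-fibre mf p))))
    go : ∀ p → fibres T (mapPlay mf p) ≋ mapPlay mmf (fibres S p)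
    go [ U ]   = [ same [ U ] ]
    go (p ▷ U) = go p ▷ same (p ▷ U)

open Subsets using (Index; extent; resp)
open MapsTo using (img; img-≐)
open FocussedPlay using (play; focus; focus∈)

private
  variable
    ℓ : Level

record Hypergraph (ℓ : Level) : Set (lsuc ℓ) where
  field
    vertices : Setoid ℓ ℓ
    edges    : Subsets vertices

open Hypergraph

record HypergraphMorphism (A B : Hypergraph ℓ) : Set ℓ where
  field
    onVertices : Func (vertices A) (vertices B)
    onEdges    : MapsTo onVertices (edges A) (edges B)

open HypergraphMorphism

HypergraphCategory : (ℓ : Level) → Category (lsuc ℓ) ℓ ℓ
HypergraphCategory ℓ = record
  { Obj = Hypergraph ℓ
  ; _⟶_ = HypergraphMorphism
  ; _≈_ = λ {A} {B} f g → ∀ x →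
            Setoid._≈_ (vertices B) (to (onVertices f) x) (to (onVertices g) x)
  ; id  = λ {A} → record { onVertices = Identity.function (vertices A)
                         ; onEdges = MapsTo-id (edges A) }
  ; _∘_ = λ {A} {B} {C} g f → record
      { onVertices = onVertices g ∘→ onVertices f
      ; onEdges = MapsTo-∘ {F = edges A} {edges B} {edges C} (onEdges g) (onEdges f) }
  ; equiv = λ {A} {B} → record
      { refl  = λ x → Setoid.refl (vertices B)
      ; sym   = λ f≈g x → Setoid.sym (vertices B) (f≈g x)
      ; trans = λ f≈g g≈h x → Setoid.trans (vertices B) (f≈g x) (g≈h x) }
  ; assoc     = λ {D = D} x → Setoid.refl (vertices D)
  ; identityˡ = λ {B = B} x → Setoid.refl (vertices B)
  ; identityʳ = λ {B = B} x → Setoid.refl (vertices B)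
  ; ∘-resp-≈  = λ {C = C} {f = f} {g′ = g′} f≈ g≈ x →
      Setoid.trans (vertices C) (cong (onVertices f) (g≈ x)) (f≈ (to (onVertices g′) x))
  }

module _ {ℓ : Level} (k : ℕ) where

  smallEdges : (A : Hypergraph ℓ) → Subsets (vertices A)
  smallEdges A = record
    { Index  = Σ[ E ∈ Index (edges A) ] Size≤ (vertices A) k (extent (edges A) E)
    ; extent = λ (E , _) → extent (edges A) E
    ; resp   = λ (E , _) → resp (edges A) E
    }

  ℍ₀ : Hypergraph ℓ → Hypergraph ℓ
  ℍ₀ A = record
    { vertices = FocussedPlays (smallEdges A)
    ; edges    = record { Index = Play (smallEdges A) ; extent = fibre ; resp = fibre-resp }
    }

  small : ∀ {A B} (f : HypergraphMorphism A B) →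
          MapsTo (onVertices f) (smallEdges A) (smallEdges B)
  small {A} {B} f = record
    { img   = λ (U , size) → img (onEdges f) U ,
                Size≤-≐ {X = vertices B} (≐-sym (img-≐ (onEdges f) U))
                        (Size≤-image (onVertices f) size)
    ; img-≐ = λ (U , _) → img-≐ (onEdges f) U }

  smallFibres : ∀ A → Fibres (smallEdges A) (smallEdges (ℍ₀ A))
  smallFibres A = record
    { fib   = λ p → p , Size≤-fibre p (proj₂ (last p))
    ; fib-≐ = λ p → ≐-refl }

  ℍ₁ : ∀ {A B} → HypergraphMorphism A B → HypergraphMorphism (ℍ₀ A) (ℍ₀ B)
  ℍ₁ f = record
    { onVertices = mapFocussed (small f)
    ; onEdges    = record { img = mapPlay (small f) ; img-≐ = λ p → ≐-sym (image-map-fibre (small f) p) }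
    }

  ℍ-functor : Functor (HypergraphCategory ℓ) (HypergraphCategory ℓ)
  ℍ-functor = record
    { F₀ = ℍ₀
    ; F₁ = ℍ₁
    ; F-resp-≈ = λ {f = f} {g} f≈g x →
        ≋⇒≈ (mapPlay-ext (small f) (small g) f≈g (play x)) (f≈g (focus x))
    ; identity = λ {A} x → ≋⇒≈ (mapPlay-id (small (Category.id (HypergraphCategory ℓ))) (play x))
                               (Setoid.refl (vertices A))
    ; homomorphism = λ {Z = Z} {f} {g} x →
        ≋⇒≈ (mapPlay-∘ (small f) (small g)
               (small (Category._∘_ (HypergraphCategory ℓ) g f)) (play x))
            (Setoid.refl (vertices Z))
    }

  ℍ-ε : ∀ A → HypergraphMorphism (ℍ₀ A) A
  ℍ-ε A = record
    { onVertices = ε-focus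
    ; onEdges    = record { img = λ p → proj₁ (last p) ; img-≐ = λ p → ≐-sym (image-ε-fibre p) } }

  ℍ-δ : ∀ A → HypergraphMorphism (ℍ₀ A) (ℍ₀ (ℍ₀ A))
  ℍ-δ A = record
    { onVertices = δ-fibres (smallFibres A)
    ; onEdges    = record { img   = fibres (smallFibres A)
                            ; img-≐ = λ p → ≐-sym (image-δ-fibre (smallFibres A) p) } }

  ℍ : Comonad (HypergraphCategory ℓ)
  ℍ = record
    { functor = ℍ-functor
    ; counit  = record { η = ℍ-ε ; natural = λ {A} {B} f x → Setoid.refl (vertices B) }
    ; comult  = record
        { η = ℍ-δ
        ; natural = λ {A} {B} f x →
            ≋⇒≈ (fibres-natural (small f) (smallFibres A) (smallFibres B) (small (ℍ₁ f)) (play x))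
                (Setoid.refl (FocussedPlays (smallEdges B))) }
    ; counitˡ = λ A x → Setoid.refl (FocussedPlays (smallEdges A))
    ; counitʳ = λ A x →
        ≋⇒≈ (map-ε-fibres (smallFibres A) (small (ℍ-ε A)) (play x)) (Setoid.refl (vertices A))
    ; coassoc = λ A x →
        ≋⇒≈ (map-δ-fibres (smallFibres A) (smallFibres (ℍ₀ A)) (small (ℍ-δ A)) (play x))
            (Setoid.refl (FocussedPlays (smallEdges (ℍ₀ A))))
    }

record Signature (ℓ : Level) : Set (lsuc ℓ) where
  field
    Symbol : Set ℓ
    arity  : Symbol → ℕ

data Guard : Set where
  atom loose : Guard

module _ {ℓ : Level} (σ : Signature ℓ) where
  open Signature σ

  record Structure : Set (lsuc ℓ) where
    field
      universe : Setoid ℓ ℓ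
      rel      : (R : Symbol) → Pred (Vector (Carrier universe) (arity R)) ℓ
      rel-resp : ∀ R {s t : Vector (Carrier universe) (arity R)} →
                 (∀ i → Setoid._≈_ universe (s i) (t i)) → rel R s → rel R t

module _ {ℓ : Level} {σ : Signature ℓ} where
  open Signature σ
  open Structure

  record Homomorphism (A B : Structure σ) : Set ℓ where
    field
      func      : Func (universe A) (universe B)
      preserves : ∀ R {t} → rel A R t → rel B R (λ i → to func (t i))

  -- Equality is an atom, so every singleton is guarded.
  data TrueAtom (A : Structure σ) : Set ℓ where
    relAtom : (R : Symbol) (t : Vector (Carrier (universe A)) (arity R)) →
              rel A R t → TrueAtom A
    eqAtom  : (a b : Carrier (universe A)) → Setoid._≈_ (universe A) a b → TrueAtom A

  OccursIn : (A : Structure σ) → TrueAtom A → Pred (Carrier (universe A)) ℓ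
  OccursIn A (relAtom R t _) c = ∃[ i ] Setoid._≈_ (universe A) c (t i)
  OccursIn A (eqAtom a b _)  c = Setoid._≈_ (universe A) c a ⊎ Setoid._≈_ (universe A) c b

  -- A guarded set is the whole set of elements of the guard: all elements of one
  -- atom, or all elements of a conjunction of atoms in which any two coexist.
  IsGuarded : Guard → (A : Structure σ) → Pred (Carrier (universe A)) ℓ → Set ℓ
  IsGuarded atom  A U = Σ[ α ∈ TrueAtom A ] U ≐ OccursIn A α
  IsGuarded loose A U =
    ∀ a b → U a → U b →
    Σ[ α ∈ TrueAtom A ] OccursIn A α a × OccursIn A α b × (∀ c → OccursIn A α c → U c)

  -- A subset with at most k elements is determined by a list of length at most
  -- k (possibly with repetitions).
  record KGuarded (g : Guard) (k : ℕ) (A : Structure σ) : Set ℓ where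
    open Membership (universe A) using (_∈_)
    field
      elements : List (Carrier (universe A))
      size     : length elements ≤ k
      guarded  : IsGuarded g A (_∈ elements)

  guardedSets : Guard → ℕ → (A : Structure σ) → Subsets (universe A)
  guardedSets g k A = record
    { Index  = KGuarded g k A
    ; extent = λ U a → a ∈ KGuarded.elements U
    ; resp   = λ U → Membershipₚ.∈-resp-≈ (universe A)
    }
    where open Membership (universe A) using (_∈_)

  open Homomorphism

  StructureCategory : Category (lsuc ℓ) ℓ ℓ
  StructureCategory = record
    { Obj = Structure σ
    ; _⟶_ = Homomorphism
    ; _≈_ = λ {A} {B} f g → ∀ x → Setoid._≈_ (universe B) (to (func f) x) (to (func g) x)
    ; id  = λ {A} → record { func = Identity.function (universe A) ; preserves = λ R r → r }
    ; _∘_ = λ g f → record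
        { func = func g ∘→ func f ; preserves = λ R r → preserves g R (preserves f R r) }
    ; equiv = λ {A} {B} → record
        { refl  = λ x → Setoid.refl (universe B)
        ; sym   = λ f≈g x → Setoid.sym (universe B) (f≈g x)
        ; trans = λ f≈g g≈h x → Setoid.trans (universe B) (f≈g x) (g≈h x) }
    ; assoc     = λ {D = D} x → Setoid.refl (universe D)
    ; identityˡ = λ {B = B} x → Setoid.refl (universe B)
    ; identityʳ = λ {B = B} x → Setoid.refl (universe B)
    ; ∘-resp-≈  = λ {C = C} {f = f} {g′ = g′} f≈ g≈ x →
        Setoid.trans (universe C) (cong (func f) (g≈ x)) (f≈ (to (func g′) x))
    }

  IsGuarded-≐ : ∀ g A {P Q : Pred (Carrier (universe A)) ℓ} →
                P ≐ Q → IsGuarded g A P → IsGuarded g A Q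
  IsGuarded-≐ atom  A P≐Q (α , P≐) = α , ≐-trans (≐-sym P≐Q) P≐
  IsGuarded-≐ loose A (P⊆Q , Q⊆P) h a b qa qb with h a b (Q⊆P qa) (Q⊆P qb)
  ... | α , a∈ , b∈ , α⊆ = α , a∈ , b∈ , λ c c∈ → P⊆Q (α⊆ c c∈)

  module _ {A B : Structure σ} (f : Homomorphism A B) where
    private
      module B = Setoid (universe B)

    mapAtom : TrueAtom A → TrueAtom B
    mapAtom (relAtom R t r) = relAtom R (λ i → to (func f) (t i)) (preserves f R r)
    mapAtom (eqAtom a b eq) = eqAtom _ _ (cong (func f) eq)

    mapAtom-occurs : ∀ α → OccursIn B (mapAtom α) ≐ image (func f) (OccursIn A α)
    mapAtom-occurs (relAtom R t r) =
        (λ (i , eq) → t i , (i , Setoid.refl (universe A)) , eq)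
      , (λ (x , (i , eq′) , eq) → i , B.trans eq (cong (func f) eq′))
    mapAtom-occurs (eqAtom a b _) =
        (λ { (inj₁ eq) → a , inj₁ (Setoid.refl (universe A)) , eq
           ; (inj₂ eq) → b , inj₂ (Setoid.refl (universe A)) , eq })
      , (λ { (x , inj₁ eq′ , eq) → inj₁ (B.trans eq (cong (func f) eq′))
           ; (x , inj₂ eq′ , eq) → inj₂ (B.trans eq (cong (func f) eq′)) })

    IsGuarded-image : ∀ g {P} → IsGuarded g A P → IsGuarded g B (image (func f) P)
    IsGuarded-image atom  (α , P≐) =
      mapAtom α , ≐-trans (image-≐ (func f) P≐) (≐-sym (mapAtom-occurs α))
    IsGuarded-image loose h a b (x , px , a≈) (y , py , b≈) with h x y px py
    ... | α , x∈ , y∈ , α⊆ =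
      mapAtom α , proj₂ (mapAtom-occurs α) (x , x∈ , a≈)
                , proj₂ (mapAtom-occurs α) (y , y∈ , b≈)
                , λ c c∈ → let z , z∈ , c≈ = proj₁ (mapAtom-occurs α) c∈ in z , α⊆ z z∈ , c≈

  guardedSet : ∀ g k A (P : Pred (Carrier (universe A)) ℓ) →
               Size≤ (universe A) k P → IsGuarded g A P →
               Σ[ U ∈ KGuarded g k A ] extent (guardedSets g k A) U ≐ P
  guardedSet g k A P (xs , size , P≐) h =
    record { elements = xs ; size = size ; guarded = IsGuarded-≐ g A P≐ h } , ≐-sym P≐

  KGuarded-Size≤ : ∀ {g k A} (U : KGuarded g k A) →
                   Size≤ (universe A) k (extent (guardedSets g k A) U)
  KGuarded-Size≤ U = KGuarded.elements U , KGuarded.size U , ≐-refl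

module _ {ℓ : Level} (σ : Signature ℓ) (g : Guard) (k : ℕ) where
  open Signature σ
  open Structure
  open Homomorphism

  H₀ : Structure σ → Hypergraph ℓ
  H₀ A = record { vertices = universe A ; edges = guardedSets g k A }

  mapsGuarded : {A B : Structure σ} (f : Homomorphism A B) →
                MapsTo (func f) (guardedSets g k A) (guardedSets g k B)
  mapsGuarded {A} {B} f = record { img = λ U → proj₁ (V U) ; img-≐ = λ U → proj₂ (V U) }
    where
    V = λ (U : KGuarded g k A) →
      guardedSet g k B _ (Size≤-image (func f) (KGuarded-Size≤ U))
                         (IsGuarded-image f g (KGuarded.guarded U))

  H : Functor (StructureCategory {σ = σ}) (HypergraphCategory ℓ)
  H = record
    { F₀ = H₀
    ; F₁ = λ f → record { onVertices = func f ; onEdges = mapsGuarded f }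
    ; F-resp-≈ = λ f≈g → f≈g
    ; identity = λ {A} x → Setoid.refl (universe A)
    ; homomorphism = λ {Z = Z} x → Setoid.refl (universe Z)
    }

  𝔾₀ : Structure σ → Structure σ
  𝔾₀ A = record
    { universe = FocussedPlays F
    ; rel      = λ R t → Σ[ p ∈ Play F ] Σ[ s ∈ Vector (Carrier (universe A)) (arity R) ]
                         Σ[ s∈ ∈ (∀ i → lastSet p (s i)) ]
                         rel A R s × (∀ i → t i P.≈ ⟨ p , s i , s∈ i ⟩)
    ; rel-resp = λ R t≈u (p , s , s∈ , r , eq) →
                   p , s , s∈ , r , λ i → P.trans (P.sym (t≈u i)) (eq i)
    }
    where
    F = guardedSets g k A
    module P = Setoid (FocussedPlays F)

  module _ (A : Structure σ) (p : Play (guardedSets g k A)) where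
    private
      F = guardedSets g k A
      module A = Setoid (universe A)
      module P = Setoid (FocussedPlays F)

    liftAtom : (α : TrueAtom A) → (∀ {c} → OccursIn A α c → lastSet p c) → TrueAtom (𝔾₀ A)
    liftAtom (relAtom R t r) α⊆ = relAtom R (λ i → ⟨ p , t i , α⊆ (i , A.refl) ⟩)
                                          (p , t , _ , r , λ i → P.refl)
    liftAtom (eqAtom a b eq) α⊆ = eqAtom ⟨ p , a , α⊆ (inj₁ A.refl) ⟩ ⟨ p , b , α⊆ (inj₂ A.refl) ⟩
                                         (≋⇒≈ ≋-refl eq)

    liftAtom-occurs⁺ : ∀ α (α⊆ : ∀ {c} → OccursIn A α c → lastSet p c) {x c} (c∈ : lastSet p c) →
                       OccursIn A α c → x P.≈ ⟨ p , c , c∈ ⟩ → OccursIn (𝔾₀ A) (liftAtom α α⊆) x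
    liftAtom-occurs⁺ (relAtom R t r) α⊆ c∈ (i , eq) x≈ = i , P.trans x≈ (≋⇒≈ ≋-refl eq)
    liftAtom-occurs⁺ (eqAtom a b _) α⊆ c∈ (inj₁ eq) x≈ = inj₁ (P.trans x≈ (≋⇒≈ ≋-refl eq))
    liftAtom-occurs⁺ (eqAtom a b _) α⊆ c∈ (inj₂ eq) x≈ = inj₂ (P.trans x≈ (≋⇒≈ ≋-refl eq))

    liftAtom-occurs⁻ : ∀ α (α⊆ : ∀ {c} → OccursIn A α c → lastSet p c) {x} →
                       OccursIn (𝔾₀ A) (liftAtom α α⊆) x → fibre p x
    liftAtom-occurs⁻ (relAtom R t r) α⊆ (i , eq) = t i , _ , eq
    liftAtom-occurs⁻ (eqAtom a b _) α⊆ (inj₁ eq) = a , _ , eq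
    liftAtom-occurs⁻ (eqAtom a b _) α⊆ (inj₂ eq) = b , _ , eq

    fibre-guarded : ∀ h → IsGuarded h A (lastSet p) → IsGuarded h (𝔾₀ A) (fibre p)
    fibre-guarded atom (α , ⊆α , α⊆) =
      liftAtom α α⊆ , (λ (a , a∈ , eq) → liftAtom-occurs⁺ α α⊆ a∈ (⊆α a∈) eq)
                    , liftAtom-occurs⁻ α α⊆
    fibre-guarded loose h x y (a , a∈ , x≈) (b , b∈ , y≈) with h a b a∈ b∈
    ... | α , a∈α , b∈α , α⊆ =
      liftAtom α (λ {c} → α⊆ c) ,
      liftAtom-occurs⁺ α (λ {c} → α⊆ c) a∈ a∈α x≈ ,
      liftAtom-occurs⁺ α (λ {c} → α⊆ c) b∈ b∈α y≈ ,
      λ c → liftAtom-occurs⁻ α (λ {c} → α⊆ c)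

  guardedFibres : (A : Structure σ) → Fibres (guardedSets g k A) (guardedSets g k (𝔾₀ A))
  guardedFibres A = record { fib = λ p → proj₁ (T p) ; fib-≐ = λ p → proj₂ (T p) }
    where
    T = λ (p : Play (guardedSets g k A)) →
      guardedSet g k (𝔾₀ A) (fibre p) (Size≤-fibre p (KGuarded-Size≤ (last p)))
                 (fibre-guarded A p g (KGuarded.guarded (last p)))

  𝔾₁ : {A B : Structure σ} → Homomorphism A B → Homomorphism (𝔾₀ A) (𝔾₀ B)
  𝔾₁ {A} {B} f = record
    { func      = mapFocussed (mapsGuarded f)
    ; preserves = λ R (p , s , s∈ , r , eq) →
        mapPlay (mapsGuarded f) p , (λ i → to (func f) (s i)) ,
        (λ i → proj₂ (mapPlay-last (mapsGuarded f) p) (s i , s∈ i , Setoid.refl (universe B))) ,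
        preserves f R r ,
        (λ i → P.trans (cong (mapFocussed (mapsGuarded f)) (eq i))
                       (≋⇒≈ ≋-refl (Setoid.refl (universe B))))
    }
    where module P = Setoid (FocussedPlays (guardedSets g k B))

  𝔾-functor : Functor (StructureCategory {σ = σ}) (StructureCategory {σ = σ})
  𝔾-functor = record
    { F₀ = 𝔾₀
    ; F₁ = 𝔾₁
    ; F-resp-≈ = λ {f = f} {h} f≈h x →
        ≋⇒≈ (mapPlay-ext (mapsGuarded f) (mapsGuarded h) f≈h (play x)) (f≈h (focus x))
    ; identity = λ {A} x → ≋⇒≈ (mapPlay-id (mapsGuarded (Category.id (StructureCategory {σ = σ}))) (play x))
                               (Setoid.refl (universe A))
    ; homomorphism = λ {Z = Z} {f} {h} x →
        ≋⇒≈ (mapPlay-∘ (mapsGuarded f) (mapsGuarded h)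
               (mapsGuarded (Category._∘_ (StructureCategory {σ = σ}) h f)) (play x))
            (Setoid.refl (universe Z))
    }

  𝔾-ε : ∀ A → Homomorphism (𝔾₀ A) A
  𝔾-ε A = record
    { func      = ε-focus
    ; preserves = λ R (p , s , s∈ , r , eq) →
        rel-resp A R (λ i → Setoid.sym (universe A) (cong (ε-focus {F = guardedSets g k A}) (eq i))) r
    }

  𝔾-δ : ∀ A → Homomorphism (𝔾₀ A) (𝔾₀ (𝔾₀ A))
  𝔾-δ A = record
    { func      = δ-fibres (guardedFibres A)
    ; preserves = λ R (p , s , s∈ , r , eq) →
        fibres (guardedFibres A) p , (λ i → ⟨ p , s i , s∈ i ⟩) ,
        (λ i → proj₂ (fibres-last (guardedFibres A) p) (s i , s∈ i , P.refl)) ,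
        (p , s , s∈ , r , λ i → P.refl) ,
        (λ i → PP.trans (cong (δ-fibres (guardedFibres A)) (eq i)) (≋⇒≈ ≋-refl P.refl))
    }
    where
    module P  = Setoid (universe (𝔾₀ A))
    module PP = Setoid (universe (𝔾₀ (𝔾₀ A)))

  𝔾 : Comonad (StructureCategory {σ = σ})
  𝔾 = record
    { functor = 𝔾-functor
    ; counit  = record { η = 𝔾-ε ; natural = λ {A} {B} f x → Setoid.refl (universe B) }
    ; comult  = record
        { η = 𝔾-δ
        ; natural = λ {A} {B} f x →
            ≋⇒≈ (fibres-natural (mapsGuarded f) (guardedFibres A) (guardedFibres B)
                   (mapsGuarded (𝔾₁ f)) (play x))
                (Setoid.refl (universe (𝔾₀ B))) }
    ; counitˡ = λ A x → Setoid.refl (universe (𝔾₀ A))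
    ; counitʳ = λ A x →
        ≋⇒≈ (map-ε-fibres (guardedFibres A) (mapsGuarded (𝔾-ε A)) (play x))
            (Setoid.refl (universe A))
    ; coassoc = λ A x →
        ≋⇒≈ (map-δ-fibres (guardedFibres A) (guardedFibres (𝔾₀ A)) (mapsGuarded (𝔾-δ A)) (play x))
            (Setoid.refl (universe (𝔾₀ (𝔾₀ A))))
    }

{-# OPTIONS --safe #-}

-- Forgetting the size bounds identifies plays of k-guarded sets with plays of
-- hyperedges of size ≤ k, so θ is essentially the identity on vertices.  What needs
-- an argument is that every k-guarded set of 𝔾 A is of the form {[p, a] ∣ a ∈ U}.
-- The plays p such that x = [p, focus x] form a subtree of the forest of plays, and
-- guardedness makes the subtrees of the elements of the set intersect pairwise; by
-- the Helly property of subtrees they share a play q, and p = q ▷ U works for U the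
-- set of foci, which is guarded since ε is a homomorphism.
module Submission where

open import Level using (Level)
open import Data.Nat.Base using (ℕ; zero; suc)
open import Data.Fin.Base using (Fin; zero; suc)
open import Data.List.Base as List using (lookup)
open import Data.List.Relation.Unary.Any using (index)
open import Data.List.Relation.Unary.Any.Properties using (lookup-index)
import Data.List.Membership.Setoid as Membership
import Data.List.Membership.Setoid.Properties as Membershipₚ
open import Data.Product.Base using (Σ-syntax; ∃-syntax; _×_; _,_; proj₁; proj₂)
open import Data.Sum.Base using (_⊎_; inj₁; inj₂; reduce)
open import Data.Empty using (⊥-elim)
open import Function.Bundles using (Func)
import Function.Construct.Identity as Identity
open import Relation.Unary using (_⊆_; _≐_)
open import Relation.Unary.Properties using (≐-sym; ≐-trans)
open import Relation.Binary.Core using (Rel)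
open import Relation.Binary.Bundles using (Setoid)
open import Relation.Binary.Definitions using (Total; Transitive)
open import Defs

open Func using (cong)
open Subsets using (Index; extent; resp)
open MapsTo using (img; img-≐)
open FocussedPlay using (play; focus; focus∈)
open Structure using (universe)

maximum : ∀ {ℓ n} {R : Rel (Fin (suc n)) ℓ} → Total R → Transitive R → ∃[ m ] ∀ i → R i m
-- Totality at a repeated argument supplies reflexivity.
maximum {n = zero} total trans = zero , λ { zero → reduce (total zero zero) }
maximum {n = suc n} total trans with maximum (λ i j → total (suc i) (suc j)) trans
... | m , ≤m with total zero (suc m)
...   | inj₁ 0≤m = suc m , λ { zero → 0≤m ; (suc i) → ≤m i }
...   | inj₂ m≤0 = zero , λ { zero → reduce (total zero zero) ; (suc i) → trans (≤m i) m≤0 }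

module _ {ℓ : Level} {X : Setoid ℓ ℓ} {F : Subsets X} where
  private
    module X = Setoid X
    module P = Setoid (FocussedPlays F)

  ⊑-antisym : ∀ {p q : Play F} → p ⊑ q → q ⊑ p → p ≋ q
  ⊑-antisym (equal e)  _   = e
  ⊑-antisym (extend l) q⊑p = ⊥-elim (⊑-irrefl (⊑-trans q⊑p l))

  Path-refl : ∀ {a} {r : Play F} → lastSet r a → Path a r r
  Path-refl = stop ≋-refl

  -- Prefixes of one play are comparable. Unlike in `Path-compare` the foci may differ, so the
  -- resulting path keeps the focus that belongs to the shorter prefix.
  Path-compare₂ : ∀ {a b} {r s p : Play F} → Path a r p → Path b s p → Path a r s ⊎ Path b s r
  Path-compare₂ π          (stop e _)   = inj₁ (Path-respʳ π (≋-sym e))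
  Path-compare₂ (stop e _) ρ@(step _ _) = inj₂ (Path-respʳ ρ (≋-sym e))
  Path-compare₂ (step π _) (step ρ _)  = Path-compare₂ π ρ

  Path-lower : ∀ {a} {r s p : Play F} → Path a r p → Path a s p → ∃[ t ] Path a t r × Path a t s
  Path-lower {r = r} {s} π ρ with Path-compare π ρ
  ... | inj₁ υ = r , Path-refl (Path-start π) , υ
  ... | inj₂ υ = s , υ , Path-refl (Path-start ρ)

  -- Each hypothesis gives a root below both `play x` and `p i`. All these roots are prefixes of
  -- `play x`, hence comparable, and the shortest serves every `i` at once.
  commonRoot : ∀ (x : FocussedPlay F) {n} (p : Fin n → Play F) → (∀ i → fibre (p i) x) →
               ∃[ r ] Path (focus x) r (play x) × (∀ i → Path (focus x) r (p i))
  commonRoot x {zero}  p x∈ = play x , Path-refl (focus∈ x) , λ ()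
  commonRoot x {suc n} p x∈ with commonRoot x (λ i → p (suc i)) (λ i → x∈ (suc i)) | x∈ zero
  ... | r , π , πs | a , a∈ , eq with ≈⇒≃ eq
  ... | ≃[ x≈a , s , ρ , τ ] with Path-lower π ρ
  ... | t , t⇝r , t⇝s =
    t , Path-trans t⇝r π , λ { zero    → Path-trans t⇝s (Path-resp-≈ (X.sym x≈a) τ)
                             ; (suc i) → Path-trans t⇝r (πs i) }

  -- Each `r i` has a path to every play witnessing a meeting of `x i`. So `r i` and `r j` are both
  -- prefixes of `p i j`, hence comparable, and the longest root lies in every subtree.
  helly : ∀ {n} (x : Fin (suc n) → FocussedPlay F) →
          (∀ i j → ∃[ p ] fibre p (x i) × fibre p (x j)) → ∃[ q ] ∀ i → fibre q (x i)
  helly {n} x meets = r (proj₁ top) , λ i →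
    focus (x i) , Path-end (proj₂ top i) ,
    ≃⇒≈ ≃[ X.refl , r i , r⇝x i , proj₂ top i ]
    where
    p : Fin (suc n) → Fin (suc n) → Play F
    p i j = proj₁ (meets i j)

    roots : ∀ i → ∃[ t ] Path (focus (x i)) t (play (x i)) ×
                         (∀ j → Path (focus (x i)) t (p i j)) × (∀ j → Path (focus (x i)) t (p j i))
    -- `meets i j` and `meets j i` may supply different plays, so the root has to serve both
    -- families.
    roots i with commonRoot (x i) (p i) (λ j → proj₁ (proj₂ (meets i j)))
               | commonRoot (x i) (λ j → p j i) (λ j → proj₂ (proj₂ (meets j i)))
    ... | s , σ , σs | t , τ , τs with Path-lower σ τ
    ... | u , υ , ω =
      u , Path-trans υ σ , (λ j → Path-trans υ (σs j)) , (λ j → Path-trans ω (τs j))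

    r : Fin (suc n) → Play F
    r i = proj₁ (roots i)

    r⇝x : ∀ i → Path (focus (x i)) (r i) (play (x i))
    r⇝x i = proj₁ (proj₂ (roots i))

    _≼_ : Rel (Fin (suc n)) ℓ
    i ≼ j = Path (focus (x i)) (r i) (r j)

    ≼-total : Total _≼_
    ≼-total i j = Path-compare₂ (proj₁ (proj₂ (proj₂ (roots i))) j)
                                (proj₂ (proj₂ (proj₂ (roots j))) i)

    ≼-trans : Transitive _≼_
    ≼-trans {i} {k = k} i≼j j≼k with ≼-total i k
    ... | inj₁ i≼k = i≼k
    -- The given paths follow different foci and cannot be concatenated; here antisymmetry of
    -- prefixes forces `r i` and `r k` to coincide.
    ... | inj₂ k≼i = stop ri≋rk (proj₁ (last-≋ ri≋rk) (Path-start (r⇝x i)))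
      where ri≋rk = ⊑-antisym (⊑-trans (Path⇒⊑ i≼j) (Path⇒⊑ j≼k)) (Path⇒⊑ k≼i)

    top : ∃[ m ] ∀ i → i ≼ m
    top = maximum ≼-total ≼-trans

  -- The last set of `q` may exceed the set `U` of foci. Appending `U` cuts it down to the foci and
  -- preserves the class of each element, whose focus lies in both last sets.
  ⊆-fibre⇒≐ : ∀ {F̂ : Subsets (FocussedPlays F)} {Û : Index F̂} {q : Play F} {U} →
              extent F̂ Û ⊆ fibre q → extent F U ≐ image ε-focus (extent F̂ Û) →
              extent F̂ Û ≐ fibre (q ▷ U)
  ⊆-fibre⇒≐ {F̂} {Û} {q} {U} Û⊆ (U⊆ , ⊆U) =
      (λ {x} x∈ → focus x , focus∈U x∈ , extended x∈ X.refl (focus∈U x∈))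
    , (λ {x} (a , a∈ , x≈) → let y , y∈ , a≈y = U⊆ a∈ in
         resp F̂ Û (P.trans (extended y∈ (X.sym a≈y) a∈) (P.sym x≈)) y∈)
    where
    focus∈U : ∀ {x} → extent F̂ Û x → extent F U (focus x)
    focus∈U {x} x∈ = ⊆U (x , x∈ , X.refl)

    extended : ∀ {x c} → extent F̂ Û x → focus x X.≈ c → (c∈ : extent F U c) →
               x P.≈ ⟨ q ▷ U , c , c∈ ⟩
    extended {x} {c} x∈ x≈c c∈ with Û⊆ x∈
    ... | a , a∈ , x≈a =
      P.trans x≈a (P.trans (≋⇒≈ ≋-refl a≈c) (Path⇒≈ (step (Path-refl c∈q) c∈) c∈q c∈))
      where
      a≈c = X.trans (X.sym (cong ε-focus x≈a)) x≈c
      c∈q = resp F (last q) a≈c a∈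

module _ {ℓ : Level} {X Y : Setoid ℓ ℓ} {F : Subsets X} {G : Subsets Y} {f : Func X Y}
         {F̂ E : Subsets (FocussedPlays F)} {Ĝ : Subsets (FocussedPlays G)} where

  -- The comultiplication law on plays, where `mmf` comes from `θ→`. As `mι` lies over the identity,
  -- the composite still lies over `mapFocussed mf`, so naturality of `fibres` applies.
  fibres-map-∘ : (mf : MapsTo f F G) (S : Fibres F F̂) (T : Fibres G Ĝ)
                 (mι : MapsTo (Identity.function (FocussedPlays F)) F̂ E)
                 (mmf : MapsTo (mapFocussed mf) E Ĝ) →
                 ∀ p → fibres T (mapPlay mf p) ≋ mapPlay mmf (mapPlay mι (fibres S p))
  fibres-map-∘ mf S T mι mmf p =
    ≋-trans (fibres-natural mf S T c p) (mapPlay-∘ mι mmf c (fibres S p))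
    where c = MapsTo-∘ mmf mι

module _ {ℓ : Level} {σ : Signature ℓ} where

  -- A single atom covers every pair, so only loose guards need to be treated.
  IsGuarded⇒loose : ∀ g (A : Structure σ) {P} → IsGuarded g A P → IsGuarded loose A P
  IsGuarded⇒loose atom  A (α , P⊆ , ⊆P) a b a∈ b∈ = α , P⊆ a∈ , P⊆ b∈ , λ _ → ⊆P
  IsGuarded⇒loose loose A h = h

module _ {ℓ : Level} (σ : Signature ℓ) (g : Guard) (k : ℕ) (A : Structure σ) where
  private
    F  = guardedSets g k A
    F̂  = guardedSets g k (𝔾₀ σ g k A)
    HA = H₀ σ g k A
    module P = Setoid (FocussedPlays F)
    open Membership (FocussedPlays F) using (_∈_)

  atomPlay : TrueAtom (𝔾₀ σ g k A) → Play F
  atomPlay (relAtom R t (p , _)) = p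
  atomPlay (eqAtom x y _)        = play x

  -- Relations of `𝔾₀` hold only between classes of a single play, and an equality atom has a single
  -- class.
  occurs⇒fibre : ∀ α → OccursIn (𝔾₀ σ g k A) α ⊆ fibre (atomPlay α)
  occurs⇒fibre (relAtom R t (p , s , s∈ , _ , eq)) (i , x≈) = s i , s∈ i , P.trans x≈ (eq i)
  occurs⇒fibre (eqAtom x y x≈y) (inj₁ z≈) = focus x , focus∈ x , z≈
  occurs⇒fibre (eqAtom x y x≈y) (inj₂ z≈) = focus x , focus∈ x , P.trans z≈ (P.sym x≈y)

  foci : KGuarded g k (𝔾₀ σ g k A) → KGuarded g k A
  foci = img (mapsGuarded σ g k (𝔾-ε σ g k A))

  -- The atom covering two elements puts both in the fibre of its play, which is the pairwise
  -- hypothesis of `helly`.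
  loose⇒common-fibre : ∀ xs → IsGuarded loose (𝔾₀ σ g k A) (_∈ xs) →
                       Play F → ∃[ q ] (_∈ xs) ⊆ fibre q
  loose⇒common-fibre List.[] h p₀ = p₀ , λ ()
  loose⇒common-fibre xs@(_ List.∷ _) h p₀ = q , λ x∈ →
    fibre-resp q (P.sym (lookup-index x∈)) (q∋ (index x∈))
    where
    common = helly (lookup xs) λ i j →
      let α , x∈ , y∈ , _ = h _ _ (Membershipₚ.∈-lookup (FocussedPlays F) xs i)
                                  (Membershipₚ.∈-lookup (FocussedPlays F) xs j)
      in atomPlay α , occurs⇒fibre α x∈ , occurs⇒fibre α y∈
    q  = proj₁ common
    q∋ = proj₂ common

  -- The default play only matters for the empty set, which may be loosely guarded.
  KGuarded⇒fibre : ∀ Û → ∃[ p ] extent F̂ Û ≐ fibre p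
  KGuarded⇒fibre Û with loose⇒common-fibre (KGuarded.elements Û)
                          (IsGuarded⇒loose g (𝔾₀ σ g k A) (KGuarded.guarded Û)) [ foci Û ]
  ... | q , Û⊆ = q ▷ foci Û , ⊆-fibre⇒≐ {F̂ = F̂} {Û} Û⊆ (img-≐ (mapsGuarded σ g k (𝔾-ε σ g k A)) Û)

  guarded→small : MapsTo (Identity.function (universe A)) F (smallEdges k HA)
  guarded→small = record
    { img   = λ U → U , KGuarded-Size≤ U
    ; img-≐ = λ U → img-≐ (MapsTo-id F) U }

  small→guarded : MapsTo (Identity.function (universe A)) (smallEdges k HA) F
  small→guarded = record { img = proj₁ ; img-≐ = λ (U , _) → img-≐ (MapsTo-id F) U }

  θ→ : HypergraphMorphism (H₀ σ g k (𝔾₀ σ g k A)) (ℍ₀ k HA)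
  θ→ = record
    { onVertices = mapFocussed guarded→small
    ; onEdges    = record
      -- Edges of `ℍ₀` are indexed by plays, so a guarded set must first be recognised as a fibre.
      { img   = λ Û → mapPlay guarded→small (proj₁ (KGuarded⇒fibre Û))
      ; img-≐ = λ Û → let p , Û≐ = KGuarded⇒fibre Û in
          ≐-trans (≐-sym (image-map-fibre guarded→small p))
                  (image-≐ (mapFocussed guarded→small) (≐-sym Û≐)) }
    }

  θ← : HypergraphMorphism (ℍ₀ k HA) (H₀ σ g k (𝔾₀ σ g k A))
  θ← = record
    { onVertices = mapFocussed small→guarded
    ; onEdges    = record
      { img   = λ p → Fibres.fib (guardedFibres σ g k A) (mapPlay small→guarded p)
      ; img-≐ = λ p → ≐-trans (Fibres.fib-≐ (guardedFibres σ g k A) (mapPlay small→guarded p))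
                              (≐-sym (image-map-fibre small→guarded p)) }
    }

module _ {ℓ : Level} (σ : Signature ℓ) (g : Guard) (k : ℕ) where
  private
    i  = guarded→small σ g k
    i⁻ = small→guarded σ g k

  θ : NaturalIsomorphism (H σ g k ∘F Comonad.functor (𝔾 σ g k))
                         (Comonad.functor (ℍ k) ∘F H σ g k)
  θ = record
    { forward = record
      { η       = θ→ σ g k
      ; natural = λ {A} {B} f x →
          let mf = mapsGuarded σ g k f
              sf = small k (Functor.F₁ (H σ g k) f)
              -- Composing with the identity on either side gives the same function, so `c` serves
              -- for both factorisations.
              c  = MapsTo-∘ (i B) mf
          in ≋⇒≈ (≋-trans (≋-sym (mapPlay-∘ mf (i B) c (play x))) (mapPlay-∘ (i A) sf c (play x)))
                 (Setoid.refl (universe B))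
      }
    ; η⁻¹  = θ← σ g k
    ; isoˡ = λ A x →
        let c = MapsTo-∘ (i⁻ A) (i A)
        in ≋⇒≈ (≋-trans (≋-sym (mapPlay-∘ (i A) (i⁻ A) c (play x))) (mapPlay-id c (play x)))
               (Setoid.refl (universe A))
    ; isoʳ = λ A x →
        let c = MapsTo-∘ (i A) (i⁻ A)
        in ≋⇒≈ (≋-trans (≋-sym (mapPlay-∘ (i⁻ A) (i A) c (play x))) (mapPlay-id c (play x)))
               (Setoid.refl (universe A))
    }

  θ-isEilenbergMooreLaw :
    IsEilenbergMooreLaw (𝔾 σ g k) (ℍ k) (H σ g k) (NaturalIsomorphism.forward θ)
  θ-isEilenbergMooreLaw = record
    { counit-law = λ A x → Setoid.refl (universe A)
    ; comult-law = λ A x → ≋⇒≈ (fibres-map-∘ _ _ _ _ _ _)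
                               (Setoid.refl (FocussedPlays (smallEdges k (H₀ σ g k A))))
    }

theorem6p4 : ∀ {ℓ : Level} (σ : Signature ℓ) (g : Guard) (k : ℕ) →
    Σ[ θ ∈ NaturalIsomorphism (H σ g k ∘F Comonad.functor (𝔾 σ g k))
    (Comonad.functor (ℍ k) ∘F H σ g k) ]
    IsEilenbergMooreLaw (𝔾 σ g k) (ℍ k) (H σ g k) (NaturalIsomorphism.forward θ)
theorem6p4 σ g k = θ σ g k , θ-isEilenbergMooreLaw σ g k
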